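{- Let $k\ge 1$ and $n\ge 0$ be integers. The total number of $k$-Motzkin paths of size $n$ is given by $$|\mathtt{Mot}(n;k)|=\frac{1}{n+1}\sum_{j=0}^{\lfloor n/k\rfloor}\binom{n+1}{n-kj}\binom{n-kj}{j}.$$
   Context: A $k$-Motzkin path of size $n$ is a lattice path from $(0,0)$ to $(n,0)$ which stays in the first quadrant (it never goes below the line $y=0$) and in which each step is either an up step $U=(1,k)$, a down step $D=(1,-1)$ or a horizontal step $H=(1,0)$. The set of such paths is denoted $\mathtt{Mot}(n;k)$. Here $\binom{a}{b}=0$ when $b>a\ge 0$. -}

module Defs where

open import Data.Integer using (ℤ; +_; 0ℤ; 1ℤ; -1ℤ; _≤_) renaming (_+_ to _+ᶻ_)
open import Data.List using (List; []; _∷_; foldl; map; upTo)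
open import Data.List.Relation.Unary.All using (All)
open import Data.Nat using (ℕ; suc)
open import Data.Nat.ListAction using (sum)
open import Data.Product using (_×_; _,_)
open import Relation.Binary.PropositionalEquality using (_≡_)

Point : Set
Point = ℤ × ℤ

origin : Point
origin = 0ℤ , 0ℤ

FirstQuadrant : Point → Set
FirstQuadrant (x , y) = 0ℤ ≤ x × 0ℤ ≤ y

data Step : Set where
  U D H : Step

displacement : ℕ → Step → Point
displacement k U = 1ℤ , + k
displacement k D = 1ℤ , -1ℤ
displacement k H = 1ℤ , 0ℤ

move : ℕ → Point → Step → Point
move k (x , y) s = let (dx , dy) = displacement k s in x +ᶻ dx , y +ᶻ dy

-- All lattice points visited from p on, including p itself and the endpoint.
vertices : ℕ → Point → List Step → List Point
vertices k p []       = p ∷ []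
vertices k p (s ∷ ss) = p ∷ vertices k (move k p s) ss

endpoint : ℕ → Point → List Step → Point
endpoint k = foldl (move k)

-- The first quadrant is convex, so requiring the vertices to lie in it is the
-- same as requiring the whole piecewise linear path to do so. Both proof fields
-- are propositions, so equality in Mot n k is equality of step sequences.
record Mot (n k : ℕ) : Set where
  constructor mot
  field
    steps : List Step
    ends  : endpoint k origin steps ≡ (+ n , 0ℤ)
    stays : All FirstQuadrant (vertices k origin steps)

-- Both bounds of the summation are inclusive: f 0 + f 1 + … + f m.
∑[0⋯_] : ℕ → (ℕ → ℕ) → ℕ
∑[0⋯ m ] f = sum (map f (upTo (suc m)))

{-# OPTIONS --safe #-}

-- Generalise to the paths of length m from height h to height 0 that stay
-- nonnegative and have exactly j up steps. Such a path has b = h + j k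
-- down steps and e = m − j − b horizontal ones, and there are
-- m! (h + 1) / (j! (b + 1)! e!) of them. This formula satisfies the recurrence given
-- by the first step: after clearing denominators the three cases contribute
--   j (h + 1 + k) + e (h + 1) + (b + 1) h = (h + 1) m.
-- For h = 0 it is the j-th summand of the statement, divided by m + 1.
module Submission where

open import Data.Empty using (⊥)
open import Data.Fin using (Fin)
open import Data.Fin.Properties using (0↔⊥; 1↔⊤; +↔⊎)
open import Data.Integer as ℤ using (+_; +≤+)
import Data.Integer.Properties as ℤ
open import Data.List using (List; []; _∷_; length; applyUpTo)
open import Data.List.Properties using (map-upTo; ∷-injectiveʳ)
open import Data.List.Relation.Unary.All as All using (All; []; _∷_)
open import Data.Nat using (ℕ; zero; suc; _+_; _*_; _∸_; _<_; z≤n; s≤s⁻¹; _!; NonZero; _/_; _%_; _≤?_)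
open import Data.Nat.Combinatorics using (_C_; nCk≡n!/k![n-k]!; k![n∸k]!∣n!; k>n⇒nCk≡0)
open import Data.Nat.DivMod using (m/n*n≡m; m≡m%n+[m/n]*n; m%n<n)
open import Data.Nat.ListAction using (sum)
open import Data.Nat.Properties hiding (≡-irrelevant)
open import Data.Nat.Tactic.RingSolver using (solve-∀)
open import Data.Product using (∃-syntax; _×_; _,_; proj₁; proj₂)
open import Data.Rational as ℚ using (ℚ)
import Data.Rational.Properties as ℚ
open import Data.Rational.Unnormalised as ℚᵘ using (mkℚᵘ; *≡*)
import Data.Rational.Unnormalised.Properties as ℚᵘ
open import Data.Sum using (_⊎_; inj₁; inj₂)
open import Data.Sum.Function.Propositional using (_⊎-↔_)
open import Data.Unit using (⊤; tt)
open import Function using (_∘_)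
open import Function.Bundles using (_↔_; mk↔ₛ′)
open import Function.Construct.Composition using (_↔-∘_)
open import Function.Construct.Symmetry using (↔-sym)
open import Relation.Binary.PropositionalEquality
  using (_≡_; refl; sym; trans; cong; cong₂; subst; module ≡-Reasoning)
open import Relation.Binary.PropositionalEquality.WithK using (≡-irrelevant)
open import Relation.Nullary using (yes; no; contradiction)
open import Defs

-- Evaluation at the predecessor, with default `z` at zero. It covers a down step, impossible at
-- height zero, and an up step, impossible when none remain.
shift : ∀ {a} {A : Set a} → A → (ℕ → A) → ℕ → A
shift z F zero    = z
shift z F (suc n) = F n

-- Paths as a recursive family in bijection with `Mot`.

module _ (k : ℕ) where

  -- Path m h: paths of length m from height h to height 0; the summands
  -- correspond to a first step U, H and D respectively.
  Path : ℕ → ℕ → Set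
  Path zero    zero    = ⊤
  Path zero    (suc _) = ⊥
  Path (suc m) h       = Path m (h + k) ⊎ (Path m h ⊎ shift ⊥ (Path m) h)

  #paths : ℕ → ℕ → ℕ
  #paths zero    zero    = 1
  #paths zero    (suc _) = 0
  #paths (suc m) h       = #paths m (h + k) + (#paths m h + shift 0 (#paths m) h)

  Path↔Fin : ∀ m h → Path m h ↔ Fin (#paths m h)
  Path↔Fin zero    zero    = ↔-sym 1↔⊤
  Path↔Fin zero    (suc h) = ↔-sym 0↔⊥
  Path↔Fin (suc m) h       =
    ↔-sym +↔⊎ ↔-∘ (Path↔Fin m (h + k) ⊎-↔ (↔-sym +↔⊎ ↔-∘ (Path↔Fin m h ⊎-↔ down h)))
    where
    down : ∀ h → shift ⊥ (Path m) h ↔ Fin (shift 0 (#paths m) h)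
    down zero    = ↔-sym 0↔⊥
    down (suc h) = Path↔Fin m h

  word : ∀ m h → Path m h → List Step
  word zero    zero    _               = []
  word (suc m) h       (inj₁ p)        = U ∷ word m (h + k) p
  word (suc m) h       (inj₂ (inj₁ p)) = H ∷ word m h p
  word (suc m) (suc h) (inj₂ (inj₂ p)) = D ∷ word m h p

  word-injective : ∀ m h p q → word m h p ≡ word m h q → p ≡ q
  word-injective zero zero _ _ _ = refl
  word-injective (suc m) h (inj₁ p) (inj₁ q) eq =
    cong inj₁ (word-injective m (h + k) p q (∷-injectiveʳ eq))
  word-injective (suc m) h (inj₂ (inj₁ p)) (inj₂ (inj₁ q)) eq =
    cong (inj₂ ∘ inj₁) (word-injective m h p q (∷-injectiveʳ eq))
  word-injective (suc m) (suc h) (inj₂ (inj₂ p)) (inj₂ (inj₂ q)) eq =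
    cong (inj₂ ∘ inj₂) (word-injective m h p q (∷-injectiveʳ eq))
  word-injective (suc m) (suc h) (inj₁ p) (inj₂ (inj₁ q)) ()
  word-injective (suc m) zero    (inj₁ p) (inj₂ (inj₁ q)) ()
  word-injective (suc m) (suc h) (inj₁ p) (inj₂ (inj₂ q)) ()
  word-injective (suc m) (suc h) (inj₂ (inj₁ p)) (inj₁ q) ()
  word-injective (suc m) zero    (inj₂ (inj₁ p)) (inj₁ q) ()
  word-injective (suc m) (suc h) (inj₂ (inj₁ p)) (inj₂ (inj₂ q)) ()
  word-injective (suc m) (suc h) (inj₂ (inj₂ p)) (inj₁ q) ()
  word-injective (suc m) (suc h) (inj₂ (inj₂ p)) (inj₂ (inj₁ q)) ()

  endpoint-word : ∀ m h p x → endpoint k (+ x , + h) (word m h p) ≡ (+ (x + m) , + 0)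
  endpoint-word zero zero _ x = cong (λ z → + z , + 0) (sym (+-identityʳ x))
  endpoint-word (suc m) h (inj₁ p) x
    rewrite sym (+-assoc x 1 m) = endpoint-word m (h + k) p (x + 1)
  -- A horizontal step computes to height `h + 0`, which needs a rewrite to become `h`; the other
  -- steps compute to the right height.
  endpoint-word (suc m) h (inj₂ (inj₁ p)) x
    rewrite sym (+-assoc x 1 m) | +-identityʳ h = endpoint-word m h p (x + 1)
  endpoint-word (suc m) (suc h) (inj₂ (inj₂ p)) x
    rewrite sym (+-assoc x 1 m) = endpoint-word m h p (x + 1)

  firstQuadrant : ∀ x h → FirstQuadrant (+ x , + h)
  firstQuadrant x h = +≤+ z≤n , +≤+ z≤n

  word-stays : ∀ m h p x → All FirstQuadrant (vertices k (+ x , + h) (word m h p))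
  word-stays zero zero _ x = firstQuadrant x 0 ∷ []
  word-stays (suc m) h (inj₁ p) x = firstQuadrant x h ∷ word-stays m (h + k) p (x + 1)
  word-stays (suc m) h (inj₂ (inj₁ p)) x
    rewrite +-identityʳ h = firstQuadrant x h ∷ word-stays m h p (x + 1)
  word-stays (suc m) (suc h) (inj₂ (inj₂ p)) x =
    firstQuadrant x (suc h) ∷ word-stays m h p (x + 1)

  -- Every step advances the abscissa by one, so the endpoint condition of `Mot n k` fixes the
  -- length of the word.
  endpoint-abscissa : ∀ ss x y → proj₁ (endpoint k (+ x , y) ss) ≡ + (x + length ss)
  endpoint-abscissa []       x y = cong +_ (sym (+-identityʳ x))
  endpoint-abscissa (U ∷ ss) x y
    rewrite sym (+-assoc x 1 (length ss)) = endpoint-abscissa ss (x + 1) _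
  endpoint-abscissa (D ∷ ss) x y
    rewrite sym (+-assoc x 1 (length ss)) = endpoint-abscissa ss (x + 1) _
  endpoint-abscissa (H ∷ ss) x y
    rewrite sym (+-assoc x 1 (length ss)) = endpoint-abscissa ss (x + 1) _

  start-stays : ∀ ss {p} → All FirstQuadrant (vertices k p ss) → FirstQuadrant p
  start-stays []      = All.head
  start-stays (_ ∷ _) = All.head

  -- The first step selects the summand of `Path`. The endpoint excludes the empty word at positive
  -- height, and the quadrant condition excludes a down step at height zero.
  word-surjective : ∀ ss h x → proj₂ (endpoint k (+ x , + h) ss) ≡ + 0 →
    All FirstQuadrant (vertices k (+ x , + h) ss) →
    ∃[ p ] word (length ss) h p ≡ ss
  word-surjective [] zero x _ _ = tt , refl
  word-surjective (U ∷ ss) h x end (_ ∷ stay) =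
    let p , eq = word-surjective ss (h + k) (x + 1) end stay in inj₁ p , cong (U ∷_) eq
  word-surjective (H ∷ ss) h x end (_ ∷ stay) =
    let p , eq = word-surjective ss h (x + 1)
                   (subst (λ z → proj₂ (endpoint k (+ (x + 1) , + z) ss) ≡ + 0) (+-identityʳ h) end)
                   (subst (λ z → All FirstQuadrant (vertices k (+ (x + 1) , + z) ss)) (+-identityʳ h) stay)
    in inj₂ (inj₁ p) , cong (H ∷_) eq
  word-surjective (D ∷ ss) zero x end (_ ∷ stay) with start-stays ss stay
  ... | _ , ()
  word-surjective (D ∷ ss) (suc h) x end (_ ∷ stay) =
    let p , eq = word-surjective ss h (x + 1) end stay in inj₂ (inj₂ p) , cong (D ∷_) eq

  Mot-≡ : ∀ {n} {a b : Mot n k} → Mot.steps a ≡ Mot.steps b → a ≡ b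
  Mot-≡ {a = mot ss end stay} {b = mot .ss end′ stay′} refl =
    cong₂ (mot ss) (≡-irrelevant end end′) (All.irrelevant firstQuadrant-irrelevant stay stay′)
    where
    firstQuadrant-irrelevant : ∀ {p} (a b : FirstQuadrant p) → a ≡ b
    firstQuadrant-irrelevant (a , b) (c , d) = cong₂ _,_ (ℤ.≤-irrelevant a c) (ℤ.≤-irrelevant b d)

  Mot-path : ∀ {n} (a : Mot n k) → ∃[ p ] word n 0 p ≡ Mot.steps a
  Mot-path (mot ss end stay)
    -- Comparing abscissas identifies `n` with `length ss`.
    with refl ← ℤ.+-injective (trans (sym (endpoint-abscissa ss 0 (+ 0))) (cong proj₁ end))
    = word-surjective ss 0 0 (cong proj₂ end) stay

  Mot↔Path : ∀ n → Mot n k ↔ Path n 0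
  Mot↔Path n = mk↔ₛ′
    (proj₁ ∘ Mot-path)
    path⇒Mot
    -- Decoding yields a path with the same word as `p`, hence `p` itself.
    (λ p → word-injective n 0 _ p (proj₂ (Mot-path (path⇒Mot p))))
    (λ a → Mot-≡ (proj₂ (Mot-path a)))
    where
    path⇒Mot : Path n 0 → Mot n k
    path⇒Mot p = mot (word n 0 p) (endpoint-word n 0 p 0) (word-stays n 0 p 0)

-- Finite sums.

∑< : ℕ → (ℕ → ℕ) → ℕ
∑< n f = sum (applyUpTo f n)

∑<-cong : ∀ n {f g : ℕ → ℕ} → (∀ i → f i ≡ g i) → ∑< n f ≡ ∑< n g
∑<-cong zero    eq = refl
∑<-cong (suc n) eq = cong₂ _+_ (eq 0) (∑<-cong n (eq ∘ suc))

∑<-zero : ∀ n → ∑< n (λ _ → 0) ≡ 0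
∑<-zero zero    = refl
∑<-zero (suc n) = ∑<-zero n

∑<-distrib-+ : ∀ n (f g : ℕ → ℕ) → ∑< n (λ i → f i + g i) ≡ ∑< n f + ∑< n g
∑<-distrib-+ zero    f g = refl
∑<-distrib-+ (suc n) f g rewrite ∑<-distrib-+ n (f ∘ suc) (g ∘ suc) =
  interchange (f 0) (g 0) (∑< n (f ∘ suc)) (∑< n (g ∘ suc))
  where
  interchange : ∀ a b c d → a + b + (c + d) ≡ a + c + (b + d)
  interchange = solve-∀

*-distribˡ-∑< : ∀ a n (f : ℕ → ℕ) → a * ∑< n f ≡ ∑< n (λ i → a * f i)
*-distribˡ-∑< a zero    f = *-zeroʳ a
*-distribˡ-∑< a (suc n) f =
  trans (*-distribˡ-+ a (f 0) _) (cong (λ s → a * f 0 + s) (*-distribˡ-∑< a n (f ∘ suc)))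

-- Counting paths by their number of up steps.

module _ (k : ℕ) where

  -- The arguments are the length, the number of up steps and the starting height.
  #paths-with-ups : ℕ → ℕ → ℕ → ℕ
  #paths-with-ups zero    zero zero = 1
  #paths-with-ups zero    _    _    = 0
  #paths-with-ups (suc m) j    h    =
    shift 0 (λ i → #paths-with-ups m i (h + k)) j
    + (#paths-with-ups m j h + shift 0 (#paths-with-ups m j) h)

  -- A path with at least `J` up steps has at least `h + J * k` down steps, more than its length, so
  -- truncating at `J` loses nothing. Each first step preserves this bound.
  #paths≡∑ : ∀ m h J → m < h + J * k → #paths k m h ≡ ∑< J (λ j → #paths-with-ups m j h)
  #paths≡∑ zero zero    (suc J) _ = cong suc (sym (∑<-zero J))
  #paths≡∑ zero (suc h) (suc J) _ = sym (∑<-zero J)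
  #paths≡∑ zero (suc h) zero    _ = refl
  #paths≡∑ (suc m) h J m<hJk = begin
    #paths k m (h + k) + (#paths k m h + shift 0 (#paths k m) h)
      ≡⟨ cong₂ _+_ (ups J m<hJk) (cong₂ _+_ (#paths≡∑ m h J (<-trans (n<1+n m) m<hJk)) (downs h m<hJk)) ⟩
    ∑< J up + (∑< J flat + ∑< J (down h))
      ≡⟨ cong (λ s → ∑< J up + s) (∑<-distrib-+ J flat (down h)) ⟨
    ∑< J up + ∑< J (λ j → flat j + down h j)
      ≡⟨ ∑<-distrib-+ J up (λ j → flat j + down h j) ⟨
    ∑< J (λ j → #paths-with-ups (suc m) j h) ∎
    where
    open ≡-Reasoning
    up flat : ℕ → ℕ
    up   j = shift 0 (λ i → #paths-with-ups m i (h + k)) j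
    flat j = #paths-with-ups m j h
    down : ℕ → ℕ → ℕ
    down h j = shift 0 (#paths-with-ups m j) h
    -- The term at zero is the default, so `suc J` terms amount to `J` terms at height `h + k`. For
    -- an empty sum, the bound says that `h` exceeds the length.
    ups : ∀ J → suc m < h + J * k → #paths k m (h + k) ≡ ∑< J up
    ups zero    lt = #paths≡∑ m (h + k) 0
      (<-≤-trans (<-trans (n<1+n m) lt) (+-monoˡ-≤ 0 (m≤m+n h k)))
    ups (suc J) lt = #paths≡∑ m (h + k) J
      (subst (m <_) (sym (+-assoc h k (J * k))) (<-trans (n<1+n m) lt))
    downs : ∀ h → suc m < h + J * k → shift 0 (#paths k m) h ≡ ∑< J (down h)
    downs zero    lt = sym (∑<-zero J)
    downs (suc h) lt = #paths≡∑ m h J (s≤s⁻¹ lt)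

  -- The `j` up steps and the `h + j * k` down steps do not fit into `m` steps.
  #paths-with-ups≡0 : ∀ m j h → m < h + j * k + j → #paths-with-ups m j h ≡ 0
  #paths-with-ups≡0 zero zero    (suc h) _ = refl
  #paths-with-ups≡0 zero (suc j) h       _ = refl
  #paths-with-ups≡0 (suc m) j h lt =
    cong₂ _+_ (up j lt)
      (cong₂ _+_ (#paths-with-ups≡0 m j h (<-trans (n<1+n m) lt)) (down h lt))
    where
    up : ∀ j → suc m < h + j * k + j → shift 0 (λ i → #paths-with-ups m i (h + k)) j ≡ 0
    up zero    _  = refl
    up (suc j) lt = #paths-with-ups≡0 m j (h + k) (s≤s⁻¹ (subst (suc m <_) (rearrange h k (j * k) j) lt))
      where
      rearrange : ∀ h k l j → h + (k + l) + suc j ≡ suc (h + k + l + j)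
      rearrange = solve-∀
    down : ∀ h → suc m < h + j * k + j → shift 0 (#paths-with-ups m j) h ≡ 0
    down zero    _  = refl
    down (suc h) lt = #paths-with-ups≡0 m j h (s≤s⁻¹ lt)

  -- Cleared denominators, and `e` given by an equation, avoid both division and truncated
  -- subtraction.
  #paths-with-ups-formula : ∀ m j h e → m ≡ h + j * k + j + e →
    #paths-with-ups m j h * (j ! * suc (h + j * k) ! * e !) ≡ m ! * suc h
  #paths-with-ups-formula zero zero    zero zero _ = refl
  #paths-with-ups-formula zero (suc j) h    e    eq =
    contradiction (sym (m+n≡0⇒n≡0 (h + suc j * k) (m+n≡0⇒m≡0 _ (sym eq)))) 0≢1+n
  #paths-with-ups-formula (suc m) j h e m≡ = begin
    (up j + (#paths-with-ups m j h + down h)) * Q j h e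
      ≡⟨ distrib (up j) (#paths-with-ups m j h) (down h) (Q j h e) ⟩
    up j * Q j h e + (#paths-with-ups m j h * Q j h e + down h * Q j h e)
      -- Each case takes the leading factor off one factorial of `Q`: `j` for up, `e` for
      -- horizontal, `suc (h + j * k)` for down. What is left is the denominator of the shorter
      -- path.
      ≡⟨ cong₂ _+_ (ups j m≡) (cong₂ _+_ (flats e m≡) (downs h m≡)) ⟩
    j * (m ! * suc (h + k)) + (e * (m ! * suc h) + suc (h + j * k) * (m ! * h))
      ≡⟨ collect j e h k (m !) ⟩
    (h + j * k + j + e) * m ! * suc h
      ≡⟨ cong (λ z → z * m ! * suc h) m≡ ⟨
    suc m * m ! * suc h ∎
    where
    open ≡-Reasoning
    up : ℕ → ℕ
    up j = shift 0 (λ i → #paths-with-ups m i (h + k)) j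
    down : ℕ → ℕ
    down h = shift 0 (#paths-with-ups m j) h
    Q : ℕ → ℕ → ℕ → ℕ
    Q j h e = j ! * suc (h + j * k) ! * e !

    distrib : ∀ a b c q → (a + (b + c)) * q ≡ a * q + (b * q + c * q)
    distrib = solve-∀
    collect : ∀ j e h k f →
      j * (f * suc (h + k)) + (e * (f * suc h) + suc (h + j * k) * (f * h))
      ≡ (h + j * k + j + e) * f * suc h
    collect = solve-∀

    ups : ∀ j → suc m ≡ h + j * k + j + e → up j * Q j h e ≡ j * (m ! * suc (h + k))
    ups zero    _  = refl
    ups (suc j) eq = begin
      g * (suc j * j ! * suc (h + (k + j * k)) ! * e !)
        -- The rest of the path, from height `h + k` with `j` up steps, has the same number of down
        -- steps.
        ≡⟨ cong (λ z → g * (suc j * j ! * suc z ! * e !)) (+-assoc h k (j * k)) ⟨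
      g * (suc j * j ! * suc (h + k + j * k) ! * e !)
        ≡⟨ pull (suc j) g (j !) (suc (h + k + j * k) !) (e !) ⟩
      suc j * (g * (j ! * suc (h + k + j * k) ! * e !))
        ≡⟨ cong (suc j *_) (#paths-with-ups-formula m j (h + k) e
             (suc-injective (trans eq (rearrange h k (j * k) j e)))) ⟩
      suc j * (m ! * suc (h + k)) ∎
      where
      g : ℕ
      g = #paths-with-ups m j (h + k)
      pull : ∀ a g x y z → g * (a * x * y * z) ≡ a * (g * (x * y * z))
      pull = solve-∀
      rearrange : ∀ h k l j e → h + (k + l) + suc j + e ≡ suc (h + k + l + j + e)
      rearrange = solve-∀

    flats : ∀ e → suc m ≡ h + j * k + j + e →
      #paths-with-ups m j h * Q j h e ≡ e * (m ! * suc h)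
    -- With `e` zero, the up and down steps already fill length `suc m`, so there is no such path of
    -- length `m`.
    flats zero    eq = cong (_* Q j h 0)
      (#paths-with-ups≡0 m j h (≤-reflexive (trans eq (+-identityʳ _))))
    flats (suc e) eq = begin
      g * (j ! * suc (h + j * k) ! * (suc e * e !))
        ≡⟨ pull (suc e) g (j !) (suc (h + j * k) !) (e !) ⟩
      suc e * (g * Q j h e)
        ≡⟨ cong (suc e *_) (#paths-with-ups-formula m j h e
             (suc-injective (trans eq (+-suc _ e)))) ⟩
      suc e * (m ! * suc h) ∎
      where
      g : ℕ
      g = #paths-with-ups m j h
      pull : ∀ a g x y z → g * (x * y * (a * z)) ≡ a * (g * (x * y * z))
      pull = solve-∀

    downs : ∀ h → suc m ≡ h + j * k + j + e →
      down h * Q j h e ≡ suc (h + j * k) * (m ! * h)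
    downs zero    _  = sym (trans (cong (suc (j * k) *_) (*-zeroʳ (m !))) (*-zeroʳ (suc (j * k))))
    downs (suc h) eq = begin
      g * (j ! * (b * suc (h + j * k) !) * e !)
        ≡⟨ pull b g (j !) (suc (h + j * k) !) (e !) ⟩
      b * (g * Q j h e)
        ≡⟨ cong (b *_) (#paths-with-ups-formula m j h e (suc-injective eq)) ⟩
      b * (m ! * suc h) ∎
      where
      g b : ℕ
      g = #paths-with-ups m j h
      b = suc (suc (h + j * k))
      pull : ∀ a g x y z → g * (x * (a * y) * z) ≡ a * (g * (x * y * z))
      pull = solve-∀

-- Binomial and trinomial coefficients.

binomial-! : ∀ a b → ((a + b) C a) * (a ! * b !) ≡ (a + b) !
binomial-! a b = begin
  ((a + b) C a) * (a ! * b !)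
    ≡⟨ cong (λ z → ((a + b) C a) * (a ! * z !)) (m+n∸m≡n a b) ⟨
  ((a + b) C a) * (a ! * (a + b ∸ a) !)
    ≡⟨ cong (_* (a ! * (a + b ∸ a) !)) (nCk≡n!/k![n-k]! (m≤m+n a b)) ⟩
  (a + b) ! / (a ! * (a + b ∸ a) !) * (a ! * (a + b ∸ a) !)
    ≡⟨ m/n*n≡m (k![n∸k]!∣n! (m≤m+n a b)) ⟩
  (a + b) ! ∎
  where
  open ≡-Reasoning
  instance _ = a !* (a + b ∸ a) !≢0

-- The product of binomials is a trinomial coefficient. The factorials are ordered as in the
-- denominator of `#paths-with-ups-formula`.
trinomial-! : ∀ a b c →
  ((a + b + c) C (a + b)) * ((a + b) C a) * (a ! * c ! * b !) ≡ (a + b + c) !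
trinomial-! a b c = begin
  ((a + b + c) C (a + b)) * ((a + b) C a) * (a ! * c ! * b !)
    ≡⟨ rearrange ((a + b + c) C (a + b)) ((a + b) C a) (a !) (c !) (b !) ⟩
  ((a + b + c) C (a + b)) * (((a + b) C a) * (a ! * b !) * c !)
    ≡⟨ cong (λ z → ((a + b + c) C (a + b)) * (z * c !)) (binomial-! a b) ⟩
  ((a + b + c) C (a + b)) * ((a + b) ! * c !)
    ≡⟨ binomial-! (a + b) c ⟩
  (a + b + c) ! ∎
  where
  open ≡-Reasoning
  rearrange : ∀ p q x y z → p * q * (x * y * z) ≡ p * (q * (x * z) * y)
  rearrange = solve-∀

-- If `j * k + j` exceeds `n`, both sides vanish. Otherwise both become `suc n !` after
-- multiplication by the common denominator `Q`.
#paths-with-ups-binomial : ∀ k n j →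
  suc n * #paths-with-ups k n j 0 ≡ (suc n C (n ∸ k * j)) * ((n ∸ k * j) C j)
#paths-with-ups-binomial k n j rewrite *-comm k j with j * k + j ≤? n
... | no ≰n = begin
  suc n * #paths-with-ups k n j 0   ≡⟨ cong (suc n *_) (#paths-with-ups≡0 k n j 0 (≰⇒> ≰n)) ⟩
  suc n * 0                         ≡⟨ *-zeroʳ (suc n) ⟩
  0                                 ≡⟨ *-zeroʳ (suc n C (n ∸ j * k)) ⟨
  (suc n C (n ∸ j * k)) * 0         ≡⟨ cong ((suc n C (n ∸ j * k)) *_) (k>n⇒nCk≡0 (few j (≰⇒> ≰n))) ⟨
  (suc n C (n ∸ j * k)) * ((n ∸ j * k) C j) ∎
  where
  open ≡-Reasoning
  few : ∀ j → n < j * k + j → n ∸ j * k < j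
  few (suc j) = m<n+o⇒m∸n<o n (suc j * k)
-- Here `e` is the number of horizontal steps, and `n` becomes `j * k + j + e`.
... | yes ≤n with e , refl ← m≤n⇒∃[o]m+o≡n ≤n
  = *-cancelʳ-≡ _ _ Q (begin
  suc n * #paths-with-ups k n j 0 * Q   ≡⟨ *-assoc (suc n) (#paths-with-ups k n j 0) Q ⟩
  suc n * (#paths-with-ups k n j 0 * Q) ≡⟨ cong (suc n *_) (#paths-with-ups-formula k n j 0 e refl) ⟩
  suc n * (n ! * 1)                     ≡⟨ cong (suc n *_) (*-identityʳ (n !)) ⟩
  suc n !                               ≡⟨ cong _! suc-n≡ ⟩
  (j + e + suc (j * k)) !               ≡⟨ trinomial-! j e (suc (j * k)) ⟨
  ((j + e + suc (j * k)) C (j + e)) * ((j + e) C j) * Q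
    ≡⟨ cong₂ (λ a b → (a C b) * (b C j) * Q) suc-n≡ n∸jk≡ ⟨
  (suc n C (n ∸ j * k)) * ((n ∸ j * k) C j) * Q ∎)
  where
  open ≡-Reasoning
  Q : ℕ
  Q = j ! * suc (j * k) ! * e !
  instance
    _ : NonZero Q
    _ = m*n≢0 _ _ {{j !* suc (j * k) !≢0}} {{e !≢0}}
  suc-n≡ : suc (j * k + j + e) ≡ j + e + suc (j * k)
  suc-n≡ = rearrange (j * k) j e
    where
    rearrange : ∀ b j e → suc (b + j + e) ≡ j + e + suc b
    rearrange = solve-∀
  n∸jk≡ : j * k + j + e ∸ j * k ≡ j + e
  n∸jk≡ = trans (cong (_∸ j * k) (+-assoc (j * k) j e)) (m+n∸m≡n (j * k) (j + e))

-- The total count as a sum.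

-- This is the truncation bound of `#paths≡∑` at height zero.
n<[1+n/k]*k : ∀ n k .{{_ : NonZero k}} → n < suc (n / k) * k
n<[1+n/k]*k n k = begin-strict
  n                   ≡⟨ m≡m%n+[m/n]*n n k ⟩
  n % k + (n / k) * k <⟨ +-monoˡ-< ((n / k) * k) (m%n<n n k) ⟩
  suc (n / k) * k     ∎
  where open ≤-Reasoning

#paths-binomial : ∀ k n .{{_ : NonZero k}} →
  suc n * #paths k n 0 ≡ ∑[0⋯ n / k ] (λ j → (suc n C (n ∸ k * j)) * ((n ∸ k * j) C j))
#paths-binomial k n = begin
  suc n * #paths k n 0
    ≡⟨ cong (suc n *_) (#paths≡∑ k n 0 J (n<[1+n/k]*k n k)) ⟩
  suc n * ∑< J (λ j → #paths-with-ups k n j 0)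
    ≡⟨ *-distribˡ-∑< (suc n) J (λ j → #paths-with-ups k n j 0) ⟩
  ∑< J (λ j → suc n * #paths-with-ups k n j 0)
    ≡⟨ ∑<-cong J (#paths-with-ups-binomial k n) ⟩
  ∑< J summand
    ≡⟨ cong sum (map-upTo summand J) ⟨
  ∑[0⋯ n / k ] summand ∎
  where
  open ≡-Reasoning
  J : ℕ
  -- The successor turns the inclusive upper bound into an exclusive one.
  J = suc (n / k)
  summand : ℕ → ℕ
  summand j = (suc n C (n ∸ k * j)) * ((n ∸ k * j) C j)

-- Passage to the rationals.

-- Equality of unnormalised fractions is cross-multiplication. `mkℚᵘ` stores the denominator minus
-- one, so `0` and `n` stand for `1` and `suc n`.
[1+n]*N≡S⇒N≃S/[1+n] : ∀ n N S → suc n * N ≡ S →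
  mkℚᵘ (+ N) 0 ℚᵘ.≃ mkℚᵘ (+ 1) n ℚᵘ.* mkℚᵘ (+ S) 0
[1+n]*N≡S⇒N≃S/[1+n] n N S eq = *≡* (begin
  + N ℤ.* + (suc n * 1) ≡⟨ ℤ.pos-* N (suc n * 1) ⟨
  + (N * (suc n * 1))   ≡⟨ cong (λ d → + (N * d)) (*-identityʳ (suc n)) ⟩
  + (N * suc n)         ≡⟨ cong +_ (trans (*-comm N (suc n)) eq) ⟩
  + S                   ≡⟨ trans (ℤ.*-identityʳ (+ 1 ℤ.* + S)) (ℤ.*-identityˡ (+ S)) ⟨
  + 1 ℤ.* + S ℤ.* + 1   ∎)
  where open ≡-Reasoning

-- Normalisation hides numerators behind a gcd, so the equation is transferred along `toℚᵘ`, which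
-- is injective and multiplicative.
[1+n]*N≡S⇒N≡S/[1+n] : ∀ n N S → suc n * N ≡ S →
  (+ N) ℚ./ 1 ≡ ((+ 1) ℚ./ suc n) ℚ.* ((+ S) ℚ./ 1)
[1+n]*N≡S⇒N≡S/[1+n] n N S eq = ℚ.toℚᵘ-injective (begin-equality
  ℚ.toℚᵘ ((+ N) ℚ./ 1)
    ≃⟨ ℚ.toℚᵘ-fromℚᵘ (mkℚᵘ (+ N) 0) ⟩
  mkℚᵘ (+ N) 0
    ≃⟨ [1+n]*N≡S⇒N≃S/[1+n] n N S eq ⟩
  mkℚᵘ (+ 1) n ℚᵘ.* mkℚᵘ (+ S) 0
    ≃⟨ ℚᵘ.*-cong (ℚ.toℚᵘ-fromℚᵘ (mkℚᵘ (+ 1) n)) (ℚ.toℚᵘ-fromℚᵘ (mkℚᵘ (+ S) 0)) ⟨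
  ℚ.toℚᵘ ((+ 1) ℚ./ suc n) ℚᵘ.* ℚ.toℚᵘ ((+ S) ℚ./ 1)
    ≃⟨ ℚ.toℚᵘ-homo-* ((+ 1) ℚ./ suc n) ((+ S) ℚ./ 1) ⟨
  ℚ.toℚᵘ (((+ 1) ℚ./ suc n) ℚ.* ((+ S) ℚ./ 1)) ∎)
  where open ℚᵘ.≤-Reasoning

proposition4p22 : (k n : ℕ) .{{_ : NonZero k}} →
    ∃[ N ] ((Mot n k ↔ Fin N) ×
    ((+ N) ℚ./ 1 ≡
    ((+ 1) ℚ./ suc n) ℚ.*
    ((+ (∑[0⋯ n / k ] (λ j → (suc n C (n ∸ k * j)) * ((n ∸ k * j) C j)))) ℚ./ 1)))
proposition4p22 k n =
  #paths k n 0 ,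
  Path↔Fin k n 0 ↔-∘ Mot↔Path k n ,
  [1+n]*N≡S⇒N≡S/[1+n] n _ _ (#paths-binomial k n)
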